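{- Let $G$ be a graph with $Z_{\mathrm{SAP}}(G)=0$. Then every matrix in $\mathcal{S}(G)$ has the Strong Arnold Property. Therefore, $M(G)=\xi(G)$, $M_+(G)=\nu(G)$, and $M_\mu(G)=\mu(G)$.
   Context: Graphs are finite, simple and undirected; $\overline{G}$ is the complement of $G$, and a non-edge of $G$ is an edge of $\overline{G}$. $N_G(i)$ is the neighborhood of $i$ and $N_G[i]=N_G(i)\cup\{i\}$. Matrices. $\mathcal{S}(G)$ is the set of real symmetric matrices indexed by $V(G)$ whose $i,j$-entry, $i\neq j$, is nonzero if $i$ and $j$ are adjacent in $G$ and zero otherwise (diagonal entries are arbitrary real numbers). $\mathcal{S}_+(G)$ is the set of positive semidefinite matrices in $\mathcal{S}(G)$. A symmetric matrix $A$ has the Strong Arnold Property (SAP) if $X=O$ is the only real symmetric matrix with $A\circ X=O$, $I\circ X=O$ and $AX=O$, where $\circ$ is the entrywise product. Let $\mathrm{null}(A)$ denote the nullity of $A$. Define $M(G)=\max\{\mathrm{null}(A):A\in\mathcal{S}(G)\}$, $M_+(G)=\max\{\mathrm{null}(A):A\in\mathcal{S}_+(G)\}$, $\xi(G)=\max\{\mathrm{null}(A):A\in\mathcal{S}(G),\ A\text{ has the SAP}\}$, $\nu(G)=\max\{\mathrm{null}(A):A\in\mathcal{S}_+(G),\ A\text{ has the SAP}\}$. $M_\mu(G)$ is the maximum nullity of matrices $A\in\mathcal{S}(G)$ such that all off-diagonal entries of $A$ are non-positive and $A$ has exactly one negative eigenvalue (counting multiplicity); $\mu(G)$ is the maximum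 nullity over those matrices in this same family that in addition have the SAP. SAP zero forcing. At every stage each non-edge of $G$ is blue or white. Let $B_E$ be the current set of blue non-edges. For a vertex $k$, let $N_{B_E}(k)=\{j:\{j,k\}\in B_E\}$. The local game at $k$ is the zero forcing game on $G$ in which the blue vertices are $\phi_k(G,B_E)=N_G[k]\cup N_{B_E}(k)$ and all other vertices are white; $i\rightarrow j$ in the local game at $k$ means that $i$ is blue, and $j$ is the only white neighbor of $i$ in $G$. The color change rule for $Z_{\mathrm{SAP}}$ consists of: (1) (forcing triple) if $\{j,k\}$ is a white non-edge and $i\rightarrow j$ in the local game at $k$ for some vertex $i$, then $\{j,k\}$ turns blue; this is denoted $(k:i\rightarrow j)$; (2) (odd cycle rule) let $\overline{G}_W$ be the graph on $V(G)$ whose edges are the white non-edges; if for some vertex $i$ the induced subgraph $\overline{G}_W[N_G(i)]$ has a connected component that is an odd cycle $C$, then all non-edges on $C$ turn blue. $Z_{\mathrm{SAP}}(G)$ is the minimum number of non-edges in an initial blue set such that every non-edge becomes blue by repeated applications of this rule. -}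

module Defs where

open import Algebra.Bundles using (CommutativeMonoid)
import Algebra.Properties.CommutativeSemigroup as CommutativeSemigroupProperties
open import Data.Bool.Base using (if_then_else_)
open import Data.Fin.Base using (Fin; toℕ)
import Data.Fin.Properties as Fin
open import Data.List.Base using (List; allFin; cartesianProduct; filter; length)
open import Data.Nat.Base as ℕ using (ℕ; suc)
import Data.Nat.Properties as ℕ
open import Data.Nat.DivMod using (_%_)
open import Data.Product.Base using (∃-syntax; Σ-syntax; _×_; _,_; proj₁; proj₂)
open import Data.Rational.Base as ℚ using (ℚ; 0ℚ; 1ℚ; ½; ∣_∣)
import Data.Rational.Properties as ℚ
open import Data.Sum.Base using (_⊎_; inj₁; inj₂)
open import Data.Vec.Functional using (Vector; foldr)
open import Function.Bundles using (_⇔_)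
open import Function.Definitions using (Injective)
open import Level using (0ℓ; Level)
open import Relation.Binary.Construct.Closure.ReflexiveTransitive using (Star)
open import Relation.Binary.Construct.Union using (_∪_)
open import Relation.Binary.Core using (Rel; _⇒_)
open import Relation.Binary.Definitions using (Symmetric; Irreflexive; Decidable)
open import Relation.Binary.PropositionalEquality
  using (_≡_; _≢_; sym; trans; cong; cong₂; subst)
open import Relation.Nullary.Decidable using (does; _×-dec_)
open import Relation.Nullary.Negation.Core using (¬_)
open import Relation.Unary using (Pred; _∈_; _∉_; _⊆_; _∩_; Satisfiable)

private
  variable
    n : ℕ
    ℓ : Level

------------------------------------------------------------------------
-- Real numbers: Cauchy sequences of rationals, with equality _≈_ meaning
-- that the difference of the two sequences tends to 0.

IsCauchy : (ℕ → ℚ) → Set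
IsCauchy x = ∀ ε → 0ℚ ℚ.< ε →
  ∃[ N ] (∀ k l → N ℕ.≤ k → N ℕ.≤ l → ∣ x k ℚ.- x l ∣ ℚ.< ε)

record ℝ : Set where
  constructor mkℝ
  field
    seq    : ℕ → ℚ
    cauchy : IsCauchy seq

open ℝ public

private
  half>0 : ∀ {ε} → 0ℚ ℚ.< ε → 0ℚ ℚ.< ½ ℚ.* ε
  half>0 {ε} ε>0 =
    subst (ℚ._< ½ ℚ.* ε) (ℚ.*-zeroʳ ½) (ℚ.*-monoʳ-<-pos ½ ε>0)

  half+half : ∀ ε → ½ ℚ.* ε ℚ.+ ½ ℚ.* ε ≡ ε
  half+half ε = trans (sym (ℚ.*-distribʳ-+ ε ½ ½)) (ℚ.*-identityˡ ε)

  cancel : ∀ a b → (a ℚ.- b) ℚ.+ b ≡ a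
  cancel a b = begin-equality
    (a ℚ.- b) ℚ.+ b        ≡⟨ ℚ.+-assoc a (ℚ.- b) b ⟩
    a ℚ.+ (ℚ.- b ℚ.+ b)    ≡⟨ cong (a ℚ.+_) (ℚ.+-inverseˡ b) ⟩
    a ℚ.+ 0ℚ               ≡⟨ ℚ.+-identityʳ a ⟩
    a                      ∎
    where open ℚ.≤-Reasoning

  telescope : ∀ a b c → (a ℚ.- b) ℚ.+ (b ℚ.- c) ≡ a ℚ.- c
  telescope a b c = begin-equality
    (a ℚ.- b) ℚ.+ (b ℚ.- c)   ≡⟨ ℚ.+-assoc (a ℚ.- b) b (ℚ.- c) ⟨
    (a ℚ.- b) ℚ.+ b ℚ.- c     ≡⟨ cong (ℚ._- c) (cancel a b) ⟩
    a ℚ.- c                   ∎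
    where open ℚ.≤-Reasoning

  *-distribˡ-- : ∀ a b c → a ℚ.* (b ℚ.- c) ≡ a ℚ.* b ℚ.- a ℚ.* c
  *-distribˡ-- a b c = begin-equality
    a ℚ.* (b ℚ.- c)                ≡⟨ ℚ.*-distribˡ-+ a b (ℚ.- c) ⟩
    a ℚ.* b ℚ.+ a ℚ.* (ℚ.- c)      ≡⟨ cong (a ℚ.* b ℚ.+_) (ℚ.neg-distribʳ-* a c) ⟨
    a ℚ.* b ℚ.- a ℚ.* c            ∎
    where open ℚ.≤-Reasoning

  IsCauchy-const : ∀ q → IsCauchy (λ _ → q)
  IsCauchy-const q ε ε>0 =
    0 , λ _ _ _ _ → subst (λ p → ∣ p ∣ ℚ.< ε) (sym (ℚ.+-inverseʳ q)) ε>0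

  IsCauchy-+ : ∀ x y → IsCauchy x → IsCauchy y → IsCauchy (λ k → x k ℚ.+ y k)
  IsCauchy-+ x y cx cy ε ε>0 = N₁ ℕ.⊔ N₂ , bound
    where
    N₁ = proj₁ (cx (½ ℚ.* ε) (half>0 ε>0))
    N₂ = proj₁ (cy (½ ℚ.* ε) (half>0 ε>0))

    rearrange : ∀ a b c d → (a ℚ.- c) ℚ.+ (b ℚ.- d) ≡ (a ℚ.+ b) ℚ.- (c ℚ.+ d)
    rearrange a b c d = begin-equality
      (a ℚ.- c) ℚ.+ (b ℚ.- d)              ≡⟨ interchange a (ℚ.- c) b (ℚ.- d) ⟩
      (a ℚ.+ b) ℚ.+ (ℚ.- c ℚ.+ ℚ.- d)      ≡⟨ cong ((a ℚ.+ b) ℚ.+_) (ℚ.neg-distrib-+ c d) ⟨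
      (a ℚ.+ b) ℚ.- (c ℚ.+ d)              ∎
      where
      open ℚ.≤-Reasoning
      open CommutativeSemigroupProperties
        (CommutativeMonoid.commutativeSemigroup ℚ.+-0-commutativeMonoid) using (interchange)

    bound : ∀ k l → N₁ ℕ.⊔ N₂ ℕ.≤ k → N₁ ℕ.⊔ N₂ ℕ.≤ l →
            ∣ (x k ℚ.+ y k) ℚ.- (x l ℚ.+ y l) ∣ ℚ.< ε
    bound k l N≤k N≤l = begin-strict
      ∣ (x k ℚ.+ y k) ℚ.- (x l ℚ.+ y l) ∣
        ≡⟨ cong ∣_∣ (rearrange (x k) (y k) (x l) (y l)) ⟨
      ∣ (x k ℚ.- x l) ℚ.+ (y k ℚ.- y l) ∣
        ≤⟨ ℚ.∣p+q∣≤∣p∣+∣q∣ (x k ℚ.- x l) (y k ℚ.- y l) ⟩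
      ∣ x k ℚ.- x l ∣ ℚ.+ ∣ y k ℚ.- y l ∣
        <⟨ ℚ.+-mono-<
             (proj₂ (cx (½ ℚ.* ε) (half>0 ε>0)) k l
               (ℕ.m⊔n≤o⇒m≤o N₁ N₂ N≤k) (ℕ.m⊔n≤o⇒m≤o N₁ N₂ N≤l))
             (proj₂ (cy (½ ℚ.* ε) (half>0 ε>0)) k l
               (ℕ.m⊔n≤o⇒n≤o N₁ N₂ N≤k) (ℕ.m⊔n≤o⇒n≤o N₁ N₂ N≤l)) ⟩
      ½ ℚ.* ε ℚ.+ ½ ℚ.* ε
        ≡⟨ half+half ε ⟩
      ε ∎
      where open ℚ.≤-Reasoning

  0<1 : 0ℚ ℚ.< 1ℚ
  0<1 = ℚ.positive⁻¹ 1ℚ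

  IsCauchy⇒bounded : ∀ x → IsCauchy x →
    ∃[ K ] ∃[ N ] 0ℚ ℚ.< K × (∀ k → N ℕ.≤ k → ∣ x k ∣ ℚ.< K)
  IsCauchy⇒bounded x cx = 1ℚ ℚ.+ ∣ x N ∣ , N , K>0 , bound
    where
    N = proj₁ (cx 1ℚ 0<1)

    K>0 : 0ℚ ℚ.< 1ℚ ℚ.+ ∣ x N ∣
    K>0 = ℚ.+-mono-<-≤ 0<1
      (ℚ.nonNegative⁻¹ ∣ x N ∣ {{ℚ.∣-∣-nonNeg (x N)}})

    bound : ∀ k → N ℕ.≤ k → ∣ x k ∣ ℚ.< 1ℚ ℚ.+ ∣ x N ∣
    bound k N≤k = begin-strict
      ∣ x k ∣                       ≡⟨ cong ∣_∣ (cancel (x k) (x N)) ⟨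
      ∣ (x k ℚ.- x N) ℚ.+ x N ∣     ≤⟨ ℚ.∣p+q∣≤∣p∣+∣q∣ (x k ℚ.- x N) (x N) ⟩
      ∣ x k ℚ.- x N ∣ ℚ.+ ∣ x N ∣   <⟨ ℚ.+-monoˡ-< ∣ x N ∣ (proj₂ (cx 1ℚ 0<1) k N N≤k ℕ.≤-refl) ⟩
      1ℚ ℚ.+ ∣ x N ∣                ∎
      where open ℚ.≤-Reasoning

  scaled : ∀ {K ε} → 0ℚ ℚ.< K → 0ℚ ℚ.< ε → ∃[ δ ] 0ℚ ℚ.< δ × K ℚ.* δ ≡ ε
  scaled {K} {ε} K>0 ε>0 = 1/K ℚ.* ε , δ>0 , eq
    where
    instance
      K-pos : ℚ.Positive K
      K-pos = ℚ.positive K>0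
      K-nz : ℚ.NonZero K
      K-nz = ℚ.>-nonZero K>0
    1/K = ℚ.1/ K
    instance
      1/K-pos : ℚ.Positive 1/K
      1/K-pos = ℚ.1/pos⇒pos K

    δ>0 : 0ℚ ℚ.< 1/K ℚ.* ε
    δ>0 = subst (ℚ._< 1/K ℚ.* ε) (ℚ.*-zeroʳ 1/K) (ℚ.*-monoʳ-<-pos 1/K ε>0)

    eq : K ℚ.* (1/K ℚ.* ε) ≡ ε
    eq = begin-equality
      K ℚ.* (1/K ℚ.* ε)   ≡⟨ ℚ.*-assoc K 1/K ε ⟨
      (K ℚ.* 1/K) ℚ.* ε   ≡⟨ cong (ℚ._* ε) (ℚ.*-inverseʳ K) ⟩
      1ℚ ℚ.* ε            ≡⟨ ℚ.*-identityˡ ε ⟩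
      ε                   ∎
      where open ℚ.≤-Reasoning

  ∣*∣-bound : ∀ p q {K δ} → 0ℚ ℚ.< K → ∣ p ∣ ℚ.< K → ∣ q ∣ ℚ.< δ →
              ∣ p ℚ.* q ∣ ℚ.< K ℚ.* δ
  ∣*∣-bound p q {K} {δ} K>0 p<K q<δ = begin-strict
    ∣ p ℚ.* q ∣         ≡⟨ ℚ.∣p*q∣≡∣p∣*∣q∣ p q ⟩
    ∣ p ∣ ℚ.* ∣ q ∣     ≤⟨ ℚ.*-monoʳ-≤-nonNeg ∣ q ∣ {{ℚ.∣-∣-nonNeg q}} (ℚ.<⇒≤ p<K) ⟩
    K ℚ.* ∣ q ∣         <⟨ ℚ.*-monoʳ-<-pos K {{ℚ.positive K>0}} q<δ ⟩
    K ℚ.* δ             ∎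
    where open ℚ.≤-Reasoning

  IsCauchy-* : ∀ x y → IsCauchy x → IsCauchy y → IsCauchy (λ k → x k ℚ.* y k)
  IsCauchy-* x y cx cy ε ε>0
    with K , N₁ , K>0 , x<K ← IsCauchy⇒bounded x cx
       | L , N₂ , L>0 , y<L ← IsCauchy⇒bounded y cy
    with δ , δ>0 , Kδ≡ε/2 ← scaled K>0 (half>0 ε>0)
       | η , η>0 , Lη≡ε/2 ← scaled L>0 (half>0 ε>0)
    with N₃ , x-close ← cx η η>0
       | N₄ , y-close ← cy δ δ>0
    = (N₁ ℕ.⊔ N₂) ℕ.⊔ (N₃ ℕ.⊔ N₄) , bound
    where
    rearrange : ∀ a b c d → a ℚ.* (b ℚ.- d) ℚ.+ d ℚ.* (a ℚ.- c) ≡ a ℚ.* b ℚ.- c ℚ.* d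
    rearrange a b c d = begin-equality
      a ℚ.* (b ℚ.- d) ℚ.+ d ℚ.* (a ℚ.- c)
        ≡⟨ cong₂ ℚ._+_ (*-distribˡ-- a b d) (*-distribˡ-- d a c) ⟩
      (a ℚ.* b ℚ.- a ℚ.* d) ℚ.+ (d ℚ.* a ℚ.- d ℚ.* c)
        ≡⟨ cong₂ (λ p q → (a ℚ.* b ℚ.- a ℚ.* d) ℚ.+ (p ℚ.- q)) (ℚ.*-comm d a) (ℚ.*-comm d c) ⟩
      (a ℚ.* b ℚ.- a ℚ.* d) ℚ.+ (a ℚ.* d ℚ.- c ℚ.* d)
        ≡⟨ telescope (a ℚ.* b) (a ℚ.* d) (c ℚ.* d) ⟩
      a ℚ.* b ℚ.- c ℚ.* d ∎
      where open ℚ.≤-Reasoning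

    bound : ∀ k l → (N₁ ℕ.⊔ N₂) ℕ.⊔ (N₃ ℕ.⊔ N₄) ℕ.≤ k →
            (N₁ ℕ.⊔ N₂) ℕ.⊔ (N₃ ℕ.⊔ N₄) ℕ.≤ l →
            ∣ x k ℚ.* y k ℚ.- x l ℚ.* y l ∣ ℚ.< ε
    bound k l N≤k N≤l = begin-strict
      ∣ x k ℚ.* y k ℚ.- x l ℚ.* y l ∣
        ≡⟨ cong ∣_∣ (rearrange (x k) (y k) (x l) (y l)) ⟨
      ∣ x k ℚ.* (y k ℚ.- y l) ℚ.+ y l ℚ.* (x k ℚ.- x l) ∣
        ≤⟨ ℚ.∣p+q∣≤∣p∣+∣q∣ (x k ℚ.* (y k ℚ.- y l)) (y l ℚ.* (x k ℚ.- x l)) ⟩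
      ∣ x k ℚ.* (y k ℚ.- y l) ∣ ℚ.+ ∣ y l ℚ.* (x k ℚ.- x l) ∣
        <⟨ ℚ.+-mono-<
             (∣*∣-bound (x k) _ K>0 (x<K k (ℕ.m⊔n≤o⇒m≤o N₁ N₂ N₁₂≤k))
               (y-close k l (ℕ.m⊔n≤o⇒n≤o N₃ N₄ N₃₄≤k) (ℕ.m⊔n≤o⇒n≤o N₃ N₄ N₃₄≤l)))
             (∣*∣-bound (y l) _ L>0 (y<L l (ℕ.m⊔n≤o⇒n≤o N₁ N₂ N₁₂≤l))
               (x-close k l (ℕ.m⊔n≤o⇒m≤o N₃ N₄ N₃₄≤k) (ℕ.m⊔n≤o⇒m≤o N₃ N₄ N₃₄≤l))) ⟩
      K ℚ.* δ ℚ.+ L ℚ.* η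
        ≡⟨ cong₂ ℚ._+_ Kδ≡ε/2 Lη≡ε/2 ⟩
      ½ ℚ.* ε ℚ.+ ½ ℚ.* ε
        ≡⟨ half+half ε ⟩
      ε ∎
      where
      open ℚ.≤-Reasoning
      N₁₂≤k = ℕ.m⊔n≤o⇒m≤o (N₁ ℕ.⊔ N₂) (N₃ ℕ.⊔ N₄) N≤k
      N₃₄≤k = ℕ.m⊔n≤o⇒n≤o (N₁ ℕ.⊔ N₂) (N₃ ℕ.⊔ N₄) N≤k
      N₁₂≤l = ℕ.m⊔n≤o⇒m≤o (N₁ ℕ.⊔ N₂) (N₃ ℕ.⊔ N₄) N≤l
      N₃₄≤l = ℕ.m⊔n≤o⇒n≤o (N₁ ℕ.⊔ N₂) (N₃ ℕ.⊔ N₄) N≤l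

-- The convergence proofs are abstract only to keep them from being unfolded: _≈_
-- and _<_ depend on nothing but the sequences.
abstract
  cauchy-const : ∀ q → IsCauchy (λ _ → q)
  cauchy-const = IsCauchy-const

  cauchy-+ : ∀ x y → IsCauchy (λ k → seq x k ℚ.+ seq y k)
  cauchy-+ x y = IsCauchy-+ (seq x) (seq y) (cauchy x) (cauchy y)

  cauchy-* : ∀ x y → IsCauchy (λ k → seq x k ℚ.* seq y k)
  cauchy-* x y = IsCauchy-* (seq x) (seq y) (cauchy x) (cauchy y)

fromℚ : ℚ → ℝ
fromℚ q = mkℝ (λ _ → q) (cauchy-const q)

0ℝ 1ℝ : ℝ
0ℝ = fromℚ 0ℚ
1ℝ = fromℚ 1ℚ

infixl 7 _*_
infixl 6 _+_
infix  4 _≈_ _≉_ _<_ _≤_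

_+_ : ℝ → ℝ → ℝ
x + y = mkℝ (λ k → seq x k ℚ.+ seq y k) (cauchy-+ x y)

_*_ : ℝ → ℝ → ℝ
x * y = mkℝ (λ k → seq x k ℚ.* seq y k) (cauchy-* x y)

record _≈_ (x y : ℝ) : Set where
  constructor mk≈
  field
    close : ∀ ε → 0ℚ ℚ.< ε →
      ∃[ N ] (∀ k → N ℕ.≤ k → ∣ seq x k ℚ.- seq y k ∣ ℚ.< ε)

open _≈_ public

_≉_ : Rel ℝ 0ℓ
x ≉ y = ¬ (x ≈ y)

record _<_ (x y : ℝ) : Set where
  constructor mk<
  field
    gap   : ℚ
    gap>0 : 0ℚ ℚ.< gap
    apart : ∃[ N ] (∀ k → N ℕ.≤ k → seq x k ℚ.+ gap ℚ.< seq y k)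

open _<_ public

_≤_ : Rel ℝ 0ℓ
x ≤ y = ¬ (y < x)

∑ : Vector ℝ n → ℝ
∑ = foldr _+_ 0ℝ

------------------------------------------------------------------------
-- Vectors and square matrices

Matrix : ℕ → Set
Matrix n = Fin n → Fin n → ℝ

infix 4 _≈ᵥ_ _≈ₘ_

_≈ᵥ_ : Rel (Vector ℝ n) 0ℓ
u ≈ᵥ v = ∀ i → u i ≈ v i

_≈ₘ_ : Rel (Matrix n) 0ℓ
A ≈ₘ B = ∀ i j → A i j ≈ B i j

0ᵥ : Vector ℝ n
0ᵥ _ = 0ℝ

O I : Matrix n
O _ _ = 0ℝ
I i j = if does (i Fin.≟ j) then 1ℝ else 0ℝ

infixl 7 _∘_ _·_ _*ᵥ_ _•_

_∘_ : Matrix n → Matrix n → Matrix n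
(A ∘ B) i j = A i j * B i j

_·_ : Matrix n → Matrix n → Matrix n
(A · B) i j = ∑ λ k → A i k * B k j

_*ᵥ_ : Matrix n → Vector ℝ n → Vector ℝ n
(A *ᵥ v) i = ∑ λ k → A i k * v k

_•_ : ℝ → Vector ℝ n → Vector ℝ n
(c • v) i = c * v i

⟨_,_⟩ : Vector ℝ n → Vector ℝ n → ℝ
⟨ u , v ⟩ = ∑ λ i → u i * v i

combination : ∀ {d} → Vector ℝ d → (Fin d → Vector ℝ n) → Vector ℝ n
combination c b i = ∑ λ k → c k * b k i

IsSymmetric : Pred (Matrix n) 0ℓ
IsSymmetric A = ∀ i j → A i j ≈ A j i

IsPSD : Pred (Matrix n) 0ℓ
IsPSD A = IsSymmetric A × (∀ v → 0ℝ ≤ ⟨ v , A *ᵥ v ⟩)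

record IsBasis {d} (V : Pred (Vector ℝ n) 0ℓ) (b : Fin d → Vector ℝ n) : Set where
  field
    member      : ∀ k → b k ∈ V
    independent : ∀ c → combination c b ≈ᵥ 0ᵥ → c ≈ᵥ 0ᵥ
    spanning    : ∀ v → v ∈ V → ∃[ c ] v ≈ᵥ combination c b

HasDim : Pred (Vector ℝ n) 0ℓ → Pred ℕ 0ℓ
HasDim {n} V d = Σ[ b ∈ (Fin d → Vector ℝ n) ] IsBasis V b

ker : Matrix n → Pred (Vector ℝ n) 0ℓ
ker A v = A *ᵥ v ≈ᵥ 0ᵥ

eigenspace : Matrix n → ℝ → Pred (Vector ℝ n) 0ℓ
eigenspace A t v = A *ᵥ v ≈ᵥ t • v

IsEigenvalue : Matrix n → Pred ℝ 0ℓ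
IsEigenvalue A t = ∃[ v ] ¬ (v ≈ᵥ 0ᵥ) × v ∈ eigenspace A t

-- The multiplicity of an eigenvalue is the dimension of its eigenspace; this is
-- only used for symmetric matrices.
HasExactlyOneNegativeEigenvalue : Pred (Matrix n) 0ℓ
HasExactlyOneNegativeEigenvalue A =
  ∃[ t ] t < 0ℝ × HasDim (eigenspace A t) 1 ×
         (∀ s → s < 0ℝ → IsEigenvalue A s → s ≈ t)

HasSAP : Pred (Matrix n) 0ℓ
HasSAP A = ∀ X → IsSymmetric X →
  A ∘ X ≈ₘ O → I ∘ X ≈ₘ O → A · X ≈ₘ O → X ≈ₘ O

------------------------------------------------------------------------
-- Graphs

record Graph (n : ℕ) : Set₁ where
  field
    Adj        : Rel (Fin n) 0ℓ
    adj-sym    : Symmetric Adj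
    adj-irrefl : Irreflexive _≡_ Adj
    adj?       : Decidable Adj

open Graph public

-- Each edge is listed once, with its smaller endpoint first.
edges : Graph n → List (Fin n × Fin n)
edges {n} G =
  filter (λ (u , v) → (u Fin.<? v) ×-dec adj? G u v)
         (cartesianProduct (allFin n) (allFin n))

NonEdge : Graph n → Rel (Fin n) 0ℓ
NonEdge G u v = u ≢ v × ¬ Adj G u v

infix 8 _↾_

_↾_ : Rel (Fin n) 0ℓ → Pred (Fin n) 0ℓ → Rel (Fin n) 0ℓ
(R ↾ S) u v = u ∈ S × v ∈ S × R u v

-- C is (the vertex set of) a connected component of the graph with vertex set S
-- and adjacency R ↾ S.
IsComponent : Rel (Fin n) 0ℓ → Pred (Fin n) 0ℓ → Pred (Fin n) 0ℓ → Set
IsComponent R S C =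
  C ⊆ S × Satisfiable C × (∀ {u} → u ∈ C → ∀ v → v ∈ C ⇔ Star (R ↾ S) u v)

CyclicallyAdjacent : (m : ℕ) .{{_ : ℕ.NonZero m}} → Rel (Fin m) 0ℓ
CyclicallyAdjacent m s t = toℕ t ≡ suc (toℕ s) % m ⊎ toℕ s ≡ suc (toℕ t) % m

-- The graph with vertex set C and adjacency R ↾ C is isomorphic to the cycle of
-- length 3 + 2k for some k.
IsOddCycle : Rel (Fin n) 0ℓ → Pred (Fin n) 0ℓ → Set
IsOddCycle {n} R C =
  ∃[ k ] Σ[ c ∈ (Fin (3 ℕ.+ 2 ℕ.* k) → Fin n) ]
    Injective _≡_ _≡_ c ×
    (∀ v → v ∈ C ⇔ (∃[ s ] c s ≡ v)) ×
    (∀ s t → R (c s) (c t) ⇔ CyclicallyAdjacent (3 ℕ.+ 2 ℕ.* k) s t)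

------------------------------------------------------------------------
-- SAP zero forcing.  A set of blue non-edges is a symmetric relation B.

⟦_,_⟧ : Fin n → Fin n → Rel (Fin n) 0ℓ
⟦ j , k ⟧ u v = (u ≡ j × v ≡ k) ⊎ (u ≡ k × v ≡ j)

module _ (G : Graph n) where

  White : Rel (Fin n) 0ℓ → Rel (Fin n) 0ℓ
  White B u v = NonEdge G u v × ¬ B u v

  φ : Fin n → Rel (Fin n) 0ℓ → Pred (Fin n) 0ℓ
  φ k B v = (v ≡ k ⊎ Adj G k v) ⊎ B k v

  -- i → j in the zero forcing game on G with blue vertex set S
  _⊢_⟶_ : Pred (Fin n) 0ℓ → Fin n → Fin n → Set
  S ⊢ i ⟶ j = i ∈ S × Adj G i j × j ∉ S × (∀ v → Adj G i v → v ∉ S → v ≡ j)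

  data Step (B : Rel (Fin n) 0ℓ) : Rel (Fin n) 0ℓ → Set₁ where
    forcingTriple : ∀ k i j → White B j k → φ k B ⊢ i ⟶ j →
                    Step B (B ∪ ⟦ j , k ⟧)
    oddCycle : ∀ i (C : Pred (Fin n) 0ℓ) →
               IsComponent (White B) (Adj G i) C → IsOddCycle (White B) C →
               Step B (B ∪ White B ↾ C)

  -- A set of non-edges is presented as a subgraph of the complement of G.
  IsForcingSet : Pred (Graph n) _
  IsForcingSet B = Adj B ⇒ NonEdge G ×
    ∃[ B′ ] Star Step (Adj B) B′ × NonEdge G ⇒ B′

------------------------------------------------------------------------
-- Graph parameters.  A parameter defined as a minimum or maximum of a set of
-- naturals is given as the predicate of being that minimum or maximum: it holds
-- of at most one number, and equality of parameters is extensional equality _≐_.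

Min Max : Pred ℕ ℓ → Pred ℕ ℓ
Min P m = m ∈ P × (∀ k → k ∈ P → m ℕ.≤ k)
Max P m = m ∈ P × (∀ k → k ∈ P → k ℕ.≤ m)

Z-SAP : Graph n → Pred ℕ _
Z-SAP G = Min λ k → ∃[ B ] IsForcingSet G B × length (edges B) ≡ k

𝒮 : Graph n → Pred (Matrix n) 0ℓ
𝒮 G A = IsSymmetric A ×
  (∀ i j → i ≢ j → (Adj G i j → A i j ≉ 0ℝ) × (¬ Adj G i j → A i j ≈ 0ℝ))

𝒮₊ : Graph n → Pred (Matrix n) 0ℓ
𝒮₊ G = 𝒮 G ∩ IsPSD

𝒮μ : Graph n → Pred (Matrix n) 0ℓ
𝒮μ G = 𝒮 G ∩ (λ A → ∀ i j → i ≢ j → A i j ≤ 0ℝ) ∩ HasExactlyOneNegativeEigenvalue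

maxNullity : Pred (Matrix n) 0ℓ → Pred ℕ 0ℓ
maxNullity F = Max λ d → ∃[ A ] A ∈ F × HasDim (ker A) d

M M₊ Mμ ξ ν μ : Graph n → Pred ℕ 0ℓ
M  G = maxNullity (𝒮 G)
M₊ G = maxNullity (𝒮₊ G)
Mμ G = maxNullity (𝒮μ G)
ξ  G = maxNullity (𝒮 G ∩ HasSAP)
ν  G = maxNullity (𝒮₊ G ∩ HasSAP)
μ  G = maxNullity (𝒮μ G ∩ HasSAP)

{-# OPTIONS --safe #-}
module Submission where

-- Let A ∈ 𝒮(G) and let X be symmetric with A ∘ X = I ∘ X = O and AX = O.  Then X
-- vanishes on the diagonal and on the edges, and X vanishes on all blue non-edges
-- at every stage of the game.  For a forcing triple (k : i → j), all terms of
-- (AX)ᵢₖ = 0 but Aᵢⱼ Xⱼₖ are zero.  For an odd cycle c₀, c₁, … of white non-edges that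
-- is a component on N(i), row i of AX and column cₚ₊₁ give
-- aₚ xₚ + aₚ₊₂ xₚ₊₁ = 0, where aₚ = A i cₚ and xₚ = X cₚ cₚ₊₁; so aₚ aₚ₊₁ xₚ alternates
-- in sign along a cycle of odd length and is zero.
--
-- Constructively, whether a vertex is blue need not be decidable, but x ≈ 0 is stable
-- under double negation, which is all that the case distinctions need.

open import Defs
open import Algebra.Bundles using (CommutativeSemiring)
import Algebra.Properties.CommutativeMonoid.Sum as Sum
open import Algebra.Structures using (IsCommutativeMonoid)
open import Algebra.Structures.Biased using (isCommutativeSemiringˡ)
open import Data.Fin.Base as Fin using (Fin; toℕ)
import Data.Fin.Properties as Fin
open import Data.List.Base using (List; []; length)
open import Data.List.Membership.Propositional using () renaming (_∈_ to _∈ₗ_)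
open import Data.List.Membership.Propositional.Properties
  using (∈-filter⁺; ∈-cartesianProduct⁺; ∈-allFin)
open import Data.Nat.Base using (ℕ)
open import Data.Nat.Base as ℕ using (zero; suc)
open import Data.Nat.DivMod
import Data.Nat.Properties as ℕ
open import Data.Product.Base using (_×_; ∃-syntax; _,_; proj₁; proj₂)
open import Data.Rational.Base as ℚ using (ℚ; 0ℚ; 1ℚ; ½; ∣_∣)
import Data.Rational.Properties as ℚ
open import Data.Rational.Solver using (module +-*-Solver)
open import Data.Sum.Base using (_⊎_; inj₁; inj₂; [_,_]′)
open import Data.Vec.Functional using (Vector; removeAt)
open import Function.Base using (_$_; case_of_; id)
open import Function.Bundles using (Equivalence)
open import Level using (0ℓ)
open import Relation.Binary.Construct.Closure.ReflexiveTransitive as Star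
  using (Star; _◅_)
open import Relation.Binary.Core using (Rel)
open import Relation.Binary.Definitions using (tri<; tri≈; tri>)
open import Relation.Binary.PropositionalEquality as ≡ using (_≡_; _≢_)
import Relation.Binary.Reasoning.Setoid as SetoidReasoning
open import Relation.Binary.Structures using (IsEquivalence)
open import Relation.Nullary.Decidable using (yes; no; dec-true; _×-dec_)
open import Relation.Nullary.Negation.Core using (¬_; contradiction)
open import Relation.Unary using (Pred; _∈_; _⊆_; _≐_; _∩_)
open +-*-Solver using (solve; _:+_; _:*_; _:-_; _:=_; con)

private
  variable
    n : ℕ
    f g : ℕ → ℚ

-- Null sequences and bounded sequences of rationals

½>0 : ∀ {ε} → 0ℚ ℚ.< ε → 0ℚ ℚ.< ½ ℚ.* ε
½>0 {ε} ε>0 = ≡.subst (ℚ._< ½ ℚ.* ε) (ℚ.*-zeroʳ ½) (ℚ.*-monoʳ-<-pos ½ ε>0)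

½+½ : ∀ ε → ½ ℚ.* ε ℚ.+ ½ ℚ.* ε ≡ ε
½+½ ε = ≡.trans (≡.sym (ℚ.*-distribʳ-+ ε ½ ½)) (ℚ.*-identityˡ ε)

Null : (ℕ → ℚ) → Set
Null f = ∀ ε → 0ℚ ℚ.< ε → ∃[ N ] (∀ k → N ℕ.≤ k → ∣ f k ∣ ℚ.< ε)

Bounded : (ℕ → ℚ) → Set
Bounded f = ∃[ K ] 0ℚ ℚ.< K × ∃[ N ] (∀ k → N ℕ.≤ k → ∣ f k ∣ ℚ.≤ K)

null-resp : (∀ k → f k ≡ g k) → Null f → Null g
null-resp f≗g f→0 ε ε>0 with N , f<ε ← f→0 ε ε>0 =
  N , λ k N≤k → ≡.subst (λ q → ∣ q ∣ ℚ.< ε) (f≗g k) (f<ε k N≤k)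

null-+ : Null f → Null g → Null (λ k → f k ℚ.+ g k)
null-+ {f} {g} f→0 g→0 ε ε>0
  with N₁ , f< ← f→0 (½ ℚ.* ε) (½>0 ε>0) | N₂ , g< ← g→0 (½ ℚ.* ε) (½>0 ε>0)
  = N₁ ℕ.⊔ N₂ , λ k N≤k → begin-strict
    ∣ f k ℚ.+ g k ∣          ≤⟨ ℚ.∣p+q∣≤∣p∣+∣q∣ (f k) (g k) ⟩
    ∣ f k ∣ ℚ.+ ∣ g k ∣      <⟨ ℚ.+-mono-< (f< k (ℕ.m⊔n≤o⇒m≤o N₁ N₂ N≤k))
                                           (g< k (ℕ.m⊔n≤o⇒n≤o N₁ N₂ N≤k)) ⟩
    ½ ℚ.* ε ℚ.+ ½ ℚ.* ε      ≡⟨ ½+½ ε ⟩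
    ε                        ∎
  where open ℚ.≤-Reasoning

null-neg : Null f → Null (λ k → ℚ.- f k)
null-neg {f} f→0 ε ε>0 with N , f<ε ← f→0 ε ε>0 =
  N , λ k N≤k → ≡.subst (ℚ._< ε) (≡.sym (ℚ.∣-p∣≡∣p∣ (f k))) (f<ε k N≤k)

null-*-bounded : Null f → Bounded g → Null (λ k → f k ℚ.* g k)
null-*-bounded {f} {g} f→0 (K , K>0 , N₂ , g≤K) ε ε>0
  = N₁ ℕ.⊔ N₂ , λ k N≤k → begin-strict
    ∣ f k ℚ.* g k ∣          ≡⟨ ℚ.∣p*q∣≡∣p∣*∣q∣ (f k) (g k) ⟩
    ∣ f k ∣ ℚ.* ∣ g k ∣      ≤⟨ ℚ.*-monoˡ-≤-nonNeg ∣ f k ∣ {{ℚ.∣-∣-nonNeg (f k)}}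
                                  (g≤K k (ℕ.m⊔n≤o⇒n≤o N₁ N₂ N≤k)) ⟩
    ∣ f k ∣ ℚ.* K            <⟨ ℚ.*-monoˡ-<-pos K (f<δ k (ℕ.m⊔n≤o⇒m≤o N₁ N₂ N≤k)) ⟩
    ε ℚ.* 1/K ℚ.* K          ≡⟨ ℚ.*-assoc ε 1/K K ⟩
    ε ℚ.* (1/K ℚ.* K)        ≡⟨ ≡.cong (ε ℚ.*_) (ℚ.*-inverseˡ K) ⟩
    ε ℚ.* 1ℚ                 ≡⟨ ℚ.*-identityʳ ε ⟩
    ε                        ∎
  where
  open ℚ.≤-Reasoning
  instance
    K-pos : ℚ.Positive K
    K-pos = ℚ.positive K>0
    K-nonZero : ℚ.NonZero K
    K-nonZero = ℚ.pos⇒nonZero K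
  1/K = ℚ.1/ K
  δ = ε ℚ.* 1/K
  δ>0 : 0ℚ ℚ.< δ
  δ>0 = ≡.subst (ℚ._< δ) (ℚ.*-zeroˡ 1/K)
    (ℚ.*-monoˡ-<-pos 1/K {{ℚ.1/pos⇒pos K}} ε>0)
  N₁ = proj₁ (f→0 δ δ>0)
  f<δ = proj₂ (f→0 δ δ>0)

∣_∣≤∣-∣+∣_∣ : ∀ p q → ∣ p ∣ ℚ.≤ ∣ p ℚ.- q ∣ ℚ.+ ∣ q ∣
∣ p ∣≤∣-∣+∣ q ∣ = begin
  ∣ p ∣                    ≡⟨ ≡.cong ∣_∣ (solve 2 (λ a b → a := (a :- b) :+ b) ≡.refl p q) ⟩
  ∣ (p ℚ.- q) ℚ.+ q ∣      ≤⟨ ℚ.∣p+q∣≤∣p∣+∣q∣ (p ℚ.- q) q ⟩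
  ∣ p ℚ.- q ∣ ℚ.+ ∣ q ∣    ∎
  where open ℚ.≤-Reasoning

bounded : ∀ x → Bounded (seq x)
bounded x with N , x-close ← cauchy x 1ℚ (ℚ.positive⁻¹ 1ℚ) =
  1ℚ ℚ.+ ∣ seq x N ∣ ,
  ℚ.+-mono-<-≤ (ℚ.positive⁻¹ 1ℚ) (ℚ.0≤∣p∣ (seq x N)) ,
  N , λ k N≤k → ℚ.≤-trans (∣ seq x k ∣≤∣-∣+∣ seq x N ∣)
    (ℚ.+-monoˡ-≤ ∣ seq x N ∣ (ℚ.<⇒≤ (x-close k N N≤k ℕ.≤-refl)))

-- The reals as a commutative semiring

≗⇒≈ : ∀ {x y} → (∀ k → seq x k ≡ seq y k) → x ≈ y
≗⇒≈ {x} x≗y = mk≈ λ ε ε>0 → 0 , λ k _ →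
  ≡.subst (λ q → ∣ q ∣ ℚ.< ε)
    (≡.trans (≡.sym (ℚ.+-inverseʳ (seq x k))) (≡.cong (λ q → seq x k ℚ.- q) (x≗y k)))
    ε>0

≈-isEquivalence : IsEquivalence _≈_
≈-isEquivalence = record
  { refl  = ≗⇒≈ λ _ → ≡.refl
  ; sym   = λ {x} {y} x≈y → mk≈ $ null-resp
      (λ k → solve 2 (λ a b → con 0ℚ :- (a :- b) := b :- a) ≡.refl (seq x k) (seq y k))
      (null-resp (λ k → ≡.sym (ℚ.+-identityˡ _)) (null-neg (close x≈y)))
  ; trans = λ {x} {y} {z} x≈y y≈z → mk≈ $ null-resp
      (λ k → solve 3 (λ a b c → (a :- b) :+ (b :- c) := a :- c) ≡.refl
        (seq x k) (seq y k) (seq z k))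
      (null-+ (close x≈y) (close y≈z))
  }

+-isCommutativeMonoid : IsCommutativeMonoid _≈_ _+_ 0ℝ
+-isCommutativeMonoid = record
  { isMonoid = record
    { isSemigroup = record
      { isMagma = record
        { isEquivalence = ≈-isEquivalence
        ; ∙-cong = λ {x} {x′} {y} {y′} x≈x′ y≈y′ → mk≈ $ null-resp
            (λ k → solve 4 (λ a a′ b b′ →
                (a :- a′) :+ (b :- b′) := (a :+ b) :- (a′ :+ b′)) ≡.refl
              (seq x k) (seq x′ k) (seq y k) (seq y′ k))
            (null-+ (close x≈x′) (close y≈y′))
        }
      ; assoc = λ x y z → ≗⇒≈ λ k → ℚ.+-assoc (seq x k) (seq y k) (seq z k)
      }
    ; identity = (λ x → ≗⇒≈ λ k → ℚ.+-identityˡ (seq x k))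
               , (λ x → ≗⇒≈ λ k → ℚ.+-identityʳ (seq x k))
    }
  ; comm = λ x y → ≗⇒≈ λ k → ℚ.+-comm (seq x k) (seq y k)
  }

*-isCommutativeMonoid : IsCommutativeMonoid _≈_ _*_ 1ℝ
*-isCommutativeMonoid = record
  { isMonoid = record
    { isSemigroup = record
      { isMagma = record
        { isEquivalence = ≈-isEquivalence
        -- Inserting the mixed term `a′ b` splits the difference of the products into two summands,
        -- each a null sequence times a bounded one.
        ; ∙-cong = λ {x} {x′} {y} {y′} x≈x′ y≈y′ → mk≈ $ null-resp
            (λ k → solve 4 (λ a a′ b b′ →
                (a :- a′) :* b :+ (b :- b′) :* a′ := a :* b :- a′ :* b′) ≡.refl
              (seq x k) (seq x′ k) (seq y k) (seq y′ k))
            (null-+ (null-*-bounded (close x≈x′) (bounded y))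
                    (null-*-bounded (close y≈y′) (bounded x′)))
        }
      ; assoc = λ x y z → ≗⇒≈ λ k → ℚ.*-assoc (seq x k) (seq y k) (seq z k)
      }
    ; identity = (λ x → ≗⇒≈ λ k → ℚ.*-identityˡ (seq x k))
               , (λ x → ≗⇒≈ λ k → ℚ.*-identityʳ (seq x k))
    }
  ; comm = λ x y → ≗⇒≈ λ k → ℚ.*-comm (seq x k) (seq y k)
  }

ℝ-commutativeSemiring : CommutativeSemiring 0ℓ 0ℓ
ℝ-commutativeSemiring = record
  { isCommutativeSemiring = isCommutativeSemiringˡ record
    { +-isCommutativeMonoid = +-isCommutativeMonoid
    ; *-isCommutativeMonoid = *-isCommutativeMonoid
    ; distribʳ = λ x y z → ≗⇒≈ λ k → ℚ.*-distribʳ-+ (seq x k) (seq y k) (seq z k)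
    ; zeroˡ    = λ x → ≗⇒≈ λ k → ℚ.*-zeroˡ (seq x k)
    }
  }

module R = CommutativeSemiring ℝ-commutativeSemiring
module ℝ-Reasoning = SetoidReasoning R.setoid

-- Apartness from zero, stability and cancellation

-- The positive form of being nonzero: unlike `x ≉ 0ℝ`, it supplies a bound `δ` to divide by.
Away : ℝ → Set
Away x = ∃[ δ ] 0ℚ ℚ.< δ × ∃[ N ] (∀ k → N ℕ.≤ k → δ ℚ.< ∣ seq x k ∣)

null⇒≈0 : ∀ {x} → Null (seq x) → x ≈ 0ℝ
null⇒≈0 {x} x→0 = mk≈ $ null-resp (λ k → ≡.sym (ℚ.+-identityʳ (seq x k))) x→0

≈0⇒null : ∀ {x} → x ≈ 0ℝ → Null (seq x)
≈0⇒null {x} x≈0 = null-resp (λ k → ℚ.+-identityʳ (seq x k)) (close x≈0)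

-- One rational comparison decides. Past `N` the terms differ by less than ε/4, so
-- `∣ seq x N ∣ < ε/2` keeps them below 3ε/4, and otherwise they stay above ε/4.
small-or-away : ∀ x ε → 0ℚ ℚ.< ε →
  (∃[ N ] (∀ k → N ℕ.≤ k → ∣ seq x k ∣ ℚ.< ε)) ⊎ Away x
small-or-away x ε ε>0 with N , x-close ← cauchy x (½ ℚ.* (½ ℚ.* ε)) (½>0 (½>0 ε>0))
                      with ∣ seq x N ∣ ℚ.<? ½ ℚ.* ε
... | yes xN<½ε = inj₁ (N , λ k N≤k → begin-strict
    ∣ seq x k ∣                           ≤⟨ ∣ seq x k ∣≤∣-∣+∣ seq x N ∣ ⟩
    ∣ seq x k ℚ.- seq x N ∣ ℚ.+ ∣ seq x N ∣
      <⟨ ℚ.+-mono-< (x-close k N N≤k ℕ.≤-refl) xN<½ε ⟩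
    ½ ℚ.* (½ ℚ.* ε) ℚ.+ ½ ℚ.* ε           <⟨ ℚ.+-monoˡ-< (½ ℚ.* ε) ¼ε<½ε ⟩
    ½ ℚ.* ε ℚ.+ ½ ℚ.* ε                   ≡⟨ ½+½ ε ⟩
    ε                                     ∎)
  where
  open ℚ.≤-Reasoning
  ¼ε<½ε : ½ ℚ.* (½ ℚ.* ε) ℚ.< ½ ℚ.* ε
  ¼ε<½ε = begin-strict
    ½ ℚ.* (½ ℚ.* ε)                       ≡⟨ ℚ.+-identityˡ _ ⟨
    0ℚ ℚ.+ ½ ℚ.* (½ ℚ.* ε)                <⟨ ℚ.+-monoˡ-< _ (½>0 (½>0 ε>0)) ⟩
    ½ ℚ.* (½ ℚ.* ε) ℚ.+ ½ ℚ.* (½ ℚ.* ε)   ≡⟨ ½+½ (½ ℚ.* ε) ⟩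
    ½ ℚ.* ε                               ∎
... | no  xN≮½ε = inj₂ (½ ℚ.* (½ ℚ.* ε) , ½>0 (½>0 ε>0) , N , λ k N≤k →
    ℚ.≰⇒> λ xk≤¼ε → xN≮½ε (begin-strict
      ∣ seq x N ∣                           ≤⟨ ∣ seq x N ∣≤∣-∣+∣ seq x k ∣ ⟩
      ∣ seq x N ℚ.- seq x k ∣ ℚ.+ ∣ seq x k ∣
        <⟨ ℚ.+-mono-<-≤ (x-close N k ℕ.≤-refl N≤k) xk≤¼ε ⟩
      ½ ℚ.* (½ ℚ.* ε) ℚ.+ ½ ℚ.* (½ ℚ.* ε)   ≡⟨ ½+½ (½ ℚ.* ε) ⟩
      ½ ℚ.* ε                               ∎))
  where open ℚ.≤-Reasoning

away⇒≉0 : ∀ {x} → Away x → x ≉ 0ℝ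
away⇒≉0 (δ , δ>0 , N₁ , δ<x) x≈0 with N₂ , x<δ ← ≈0⇒null x≈0 δ δ>0 =
  ℚ.<-asym (δ<x (N₁ ℕ.⊔ N₂) (ℕ.m≤m⊔n N₁ N₂)) (x<δ (N₁ ℕ.⊔ N₂) (ℕ.m≤n⊔m N₁ N₂))

¬away⇒≈0 : ∀ {x} → ¬ Away x → x ≈ 0ℝ
¬away⇒≈0 {x} ¬away = null⇒≈0 λ ε ε>0 →
  [ id , (λ away → contradiction away ¬away) ]′ (small-or-away x ε ε>0)

-- Being apart from zero refutes `x ≈ 0ℝ`, so the hypothesis excludes `Away x`; then `small-or-away`
-- must answer "small" for every ε.
≈0-stable : ∀ {x} → ¬ x ≉ 0ℝ → x ≈ 0ℝ
≈0-stable ¬x≉0 = ¬away⇒≈0 λ away → ¬x≉0 (away⇒≉0 away)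

away-cancel : ∀ {x y} → Away x → x * y ≈ 0ℝ → y ≈ 0ℝ
away-cancel {x} {y} (δ , δ>0 , N₁ , δ<x) xy≈0 = null⇒≈0 λ ε ε>0 →
  let N₂ , xy<δε = ≈0⇒null xy≈0 (δ ℚ.* ε)
        (≡.subst (ℚ._< δ ℚ.* ε) (ℚ.*-zeroʳ δ) (ℚ.*-monoʳ-<-pos δ ε>0))
  in N₁ ℕ.⊔ N₂ , λ k N≤k → ℚ.*-cancelˡ-<-nonNeg δ {{ℚ.pos⇒nonNeg δ}} (begin-strict
    δ ℚ.* ∣ seq y k ∣              ≤⟨ ℚ.*-monoʳ-≤-nonNeg ∣ seq y k ∣ {{ℚ.∣-∣-nonNeg (seq y k)}}
                                        (ℚ.<⇒≤ (δ<x k (ℕ.m⊔n≤o⇒m≤o N₁ N₂ N≤k))) ⟩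
    ∣ seq x k ∣ ℚ.* ∣ seq y k ∣    ≡⟨ ℚ.∣p*q∣≡∣p∣*∣q∣ (seq x k) (seq y k) ⟨
    ∣ seq x k ℚ.* seq y k ∣        <⟨ xy<δε k (ℕ.m⊔n≤o⇒n≤o N₁ N₂ N≤k) ⟩
    δ ℚ.* ε                        ∎)
  where
  open ℚ.≤-Reasoning
  instance
    δ-pos : ℚ.Positive δ
    δ-pos = ℚ.positive δ>0

-- No lower bound can be read off from `x ≉ 0ℝ`, but the goal is stable: if `y ≉ 0ℝ`, then
-- `away-cancel` excludes `Away x`, which forces `x ≈ 0ℝ`.
xy≈0∧x≉0⇒y≈0 : ∀ {x y} → x * y ≈ 0ℝ → x ≉ 0ℝ → y ≈ 0ℝ
xy≈0∧x≉0⇒y≈0 xy≈0 x≉0 = ≈0-stable λ y≉0 →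
  x≉0 (¬away⇒≈0 λ away → y≉0 (away-cancel away xy≈0))

x+x≈0⇒x≈0 : ∀ {x} → x + x ≈ 0ℝ → x ≈ 0ℝ
x+x≈0⇒x≈0 {x} x+x≈0 = begin
  x                   ≈⟨ ≗⇒≈ (λ k → ≡.trans (≡.sym (½+½ (seq x k)))
                           (≡.sym (ℚ.*-distribˡ-+ ½ (seq x k) (seq x k)))) ⟩
  fromℚ ½ * (x + x)   ≈⟨ R.*-congˡ x+x≈0 ⟩
  fromℚ ½ * 0ℝ        ≈⟨ R.zeroʳ (fromℚ ½) ⟩
  0ℝ                  ∎
  where open ℝ-Reasoning

-- Finite sums with one or two nonzero terms

private
  module ∑ = Sum R.+-commutativeMonoid

∑-zero : (f : Vector ℝ n) → (∀ i → f i ≈ 0ℝ) → ∑ f ≈ 0ℝ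
∑-zero {n} f f≈0 = R.trans (∑.sum-cong-≋ f≈0) (∑.sum-replicate-zero n)

∑-single : ∀ (f : Vector ℝ n) i → (∀ v → v ≢ i → f v ≈ 0ℝ) → ∑ f ≈ f i
∑-single {suc n} f i f≈0 = begin
  ∑ f                      ≈⟨ ∑.sum-remove f ⟩
  f i + ∑ (removeAt f i)   ≈⟨ R.+-congˡ (∑-zero (removeAt f i) λ v →
                                f≈0 (Fin.punchIn i v) (Fin.punchInᵢ≢i i v)) ⟩
  f i + 0ℝ                 ≈⟨ R.+-identityʳ (f i) ⟩
  f i                      ∎
  where open ℝ-Reasoning

∑-pair : ∀ (f : Vector ℝ n) {i j} → i ≢ j →
  (∀ v → v ≢ i → v ≢ j → f v ≈ 0ℝ) → ∑ f ≈ f i + f j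
∑-pair {suc n} f {i} {j} i≢j f≈0 = begin
  ∑ f                                ≈⟨ ∑.sum-remove f ⟩
  f i + ∑ (removeAt f i)             ≈⟨ R.+-congˡ (∑-single (removeAt f i) j′ λ v v≢j′ →
    f≈0 (Fin.punchIn i v) (Fin.punchInᵢ≢i i v) λ eq →
      v≢j′ (Fin.punchIn-injective i v j′ (≡.trans eq (≡.sym (Fin.punchIn-punchOut i≢j))))) ⟩
  -- `j′` is the position of `j` once `i` has been removed.
  f i + f (Fin.punchIn i j′)         ≡⟨ ≡.cong (λ v → f i + f v) (Fin.punchIn-punchOut i≢j) ⟩
  f i + f j                          ∎
  where
  open ℝ-Reasoning
  j′ = Fin.punchOut i≢j

-- Residues and adjacency on a cycle

-- Adding `l`, which is `m` minus one, undoes the successor modulo `m`.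
suc-%-injective : ∀ a b m .{{_ : ℕ.NonZero m}} →
  suc a % m ≡ suc b % m → a % m ≡ b % m
suc-%-injective a b m@(suc l) eq = begin
  a % m                        ≡⟨ shift a ⟨
  (suc a % m ℕ.+ l % m) % m    ≡⟨ ≡.cong (λ r → (r ℕ.+ l % m) % m) eq ⟩
  (suc b % m ℕ.+ l % m) % m    ≡⟨ shift b ⟩
  b % m                        ∎
  where
  open ≡.≡-Reasoning
  shift : ∀ c → (suc c % m ℕ.+ l % m) % m ≡ c % m
  shift c = begin
    (suc c % m ℕ.+ l % m) % m   ≡⟨ %-distribˡ-+ (suc c) l m ⟨
    (suc c ℕ.+ l) % m           ≡⟨ ≡.cong (_% m) (ℕ.+-suc c l) ⟨
    (c ℕ.+ m) % m               ≡⟨ [m+n]%n≡m%n c m ⟩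
    c % m                       ∎

suc-%-% : ∀ a m .{{_ : ℕ.NonZero m}} → suc (a % m) % m ≡ suc a % m
suc-%-% a m = begin
  suc (a % m) % m               ≡⟨ %-distribˡ-+ 1 (a % m) m ⟩
  (1 % m ℕ.+ a % m % m) % m     ≡⟨ ≡.cong (λ r → (1 % m ℕ.+ r) % m) (m%n%n≡m%n a m) ⟩
  (1 % m ℕ.+ a % m) % m         ≡⟨ %-distribˡ-+ 1 a m ⟨
  suc a % m                     ∎
  where open ≡.≡-Reasoning

-- Cancelling successors reduces to `p = 0`, where the residues compute to 2 and 0 because the
-- modulus is at least 3.
2+p%m≢p%m : ∀ k p → (2 ℕ.+ p) % (3 ℕ.+ k) ≢ p % (3 ℕ.+ k)
2+p%m≢p%m k zero    ()
2+p%m≢p%m k (suc p) eq =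
  2+p%m≢p%m k p (suc-%-injective (2 ℕ.+ p) p (3 ℕ.+ k) eq)

module _ (m : ℕ) .{{_ : ℕ.NonZero m}} where

  toℕ-mod : ∀ p → toℕ (p mod m) ≡ p % m
  toℕ-mod p = Fin.toℕ-fromℕ< (m%n<n p m)

  ≡-mod : ∀ {p} {t : Fin m} → toℕ t ≡ p % m → t ≡ p mod m
  ≡-mod {p} eq = Fin.toℕ-injective (≡.trans eq (≡.sym (toℕ-mod p)))

  toℕ-% : (t : Fin m) → toℕ t % m ≡ toℕ t
  toℕ-% t = m<n⇒m%n≡m (Fin.toℕ<n t)

  mod-+-period : ∀ p → (m ℕ.+ p) mod m ≡ p mod m
  mod-+-period p = ≡-mod (≡.trans (toℕ-mod (m ℕ.+ p))
    (≡.trans (≡.cong (_% m) (ℕ.+-comm m p)) ([m+n]%n≡m%n p m)))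

  mod-suc : ∀ p {t : Fin m} → toℕ t ≡ suc (toℕ (p mod m)) % m → t ≡ suc p mod m
  mod-suc p eq = ≡-mod (≡.trans eq
    (≡.trans (≡.cong (λ r → suc r % m) (toℕ-mod p)) (suc-%-% p m)))

  mod-pred : ∀ p {t : Fin m} → toℕ (suc p mod m) ≡ suc (toℕ t) % m → t ≡ p mod m
  mod-pred p {t} eq = ≡-mod (≡.trans (≡.sym (toℕ-% t))
    (suc-%-injective (toℕ t) p m (≡.trans (≡.sym eq) (toℕ-mod (suc p)))))

  -- Centred at `suc p`, so that the predecessor is `p` and no subtraction occurs.
  cyclic-neighbours : ∀ p {t} → CyclicallyAdjacent m (suc p mod m) t →
    t ≡ p mod m ⊎ t ≡ (2 ℕ.+ p) mod m
  cyclic-neighbours p (inj₁ eq) = inj₂ (mod-suc (suc p) eq)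
  cyclic-neighbours p (inj₂ eq) = inj₁ (mod-pred p eq)

  -- Brings an arbitrary edge of the cycle, in either orientation, into the form of two consecutive
  -- terms of a sequence indexed by `ℕ`.
  cyclic-consecutive : ∀ {s t} → CyclicallyAdjacent m s t →
    ∃[ p ] (s ≡ p mod m × t ≡ suc p mod m ⊎ t ≡ p mod m × s ≡ suc p mod m)
  cyclic-consecutive {s} {t} (inj₁ t≡1+s) =
    toℕ s , inj₁ (≡-mod (≡.sym (toℕ-% s)) , ≡-mod t≡1+s)
  cyclic-consecutive {s} {t} (inj₂ s≡1+t) =
    toℕ t , inj₂ (≡-mod (≡.sym (toℕ-% t)) , ≡-mod s≡1+t)

-- Sequences that alternate in sign

x+y≈0∧y+z≈0⇒x≈z : ∀ {x y z} → x + y ≈ 0ℝ → y + z ≈ 0ℝ → x ≈ z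
x+y≈0∧y+z≈0⇒x≈z {x} {y} {z} x+y≈0 y+z≈0 = begin
  x             ≈⟨ R.+-identityʳ x ⟨
  x + 0ℝ        ≈⟨ R.+-congˡ y+z≈0 ⟨
  x + (y + z)   ≈⟨ R.+-assoc x y z ⟨
  x + y + z     ≈⟨ R.+-congʳ x+y≈0 ⟩
  0ℝ + z        ≈⟨ R.+-identityˡ z ⟩
  z             ∎
  where open ℝ-Reasoning

module _ (y : ℕ → ℝ) (alternating : ∀ p → y p + y (suc p) ≈ 0ℝ) where

  alternating-even : ∀ k p → y (2 ℕ.* k ℕ.+ p) ≈ y p
  alternating-even zero    p = R.refl
  alternating-even (suc k) p rewrite ℕ.+-suc k (k ℕ.+ 0) = R.trans
    (R.sym (x+y≈0∧y+z≈0⇒x≈z (alternating _) (alternating _)))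
    (alternating-even k p)

  -- The period is one more than `2 * suc k`. Even shifts preserve `y`, so a full period identifies
  -- `y p` with `y (suc p)`; their sum is zero, hence twice `y p` is zero.
  alternating-odd-period : ∀ k → (∀ p → y ((3 ℕ.+ 2 ℕ.* k) ℕ.+ p) ≈ y p) → ∀ p → y p ≈ 0ℝ
  alternating-odd-period k periodic p =
    x+x≈0⇒x≈0 (R.trans (R.+-congˡ yp≈y[1+p]) (alternating p))
    where
    open ℝ-Reasoning
    yp≈y[1+p] : y p ≈ y (suc p)
    yp≈y[1+p] = begin
      y p                            ≈⟨ periodic p ⟨
      y (3 ℕ.+ 2 ℕ.* k ℕ.+ p)        ≡⟨ ≡.cong (λ q → y (suc q ℕ.+ p)) (ℕ.*-suc 2 k) ⟨
      y (suc (2 ℕ.* suc k ℕ.+ p))    ≡⟨ ≡.cong y (ℕ.+-suc (2 ℕ.* suc k) p) ⟨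
      y (2 ℕ.* suc k ℕ.+ suc p)      ≈⟨ alternating-even (suc k) (suc p) ⟩
      y (suc p)                      ∎

-- Graphs without edges

-- `edges` lists only pairs with the smaller endpoint first, so an edge is oriented by trichotomy
-- before it is looked up.
edges-empty : (B : Graph n) → length (edges B) ≡ 0 → ∀ {u v} → ¬ Adj B u v
edges-empty {n} B no-edges {u} {v} uv = case Fin.<-cmp u v of λ where
    (tri< u<v _ _) → no-<-edge u<v uv
    (tri≈ _ u≡v _) → adj-irrefl B u≡v uv
    (tri> _ _ v<u) → no-<-edge v<u (adj-sym B uv)
  where
  empty : ∀ {xs : List (Fin n × Fin n)} {e} → length xs ≡ 0 → ¬ e ∈ₗ xs
  empty {[]} _ ()

  no-<-edge : ∀ {u v} → u Fin.< v → ¬ Adj B u v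
  no-<-edge u<v uv = empty no-edges
    (∈-filter⁺ (λ (u , v) → (u Fin.<? v) ×-dec adj? B u v)
      (∈-cartesianProduct⁺ (∈-allFin _) (∈-allFin _)) (u<v , uv))

-- The matrix X vanishes on blue non-edges throughout the game

module _ (G : Graph n) {A X : Matrix n} (A∈𝒮 : A ∈ 𝒮 G) (X-sym : IsSymmetric X)
         (A∘X≈O : A ∘ X ≈ₘ O) (I∘X≈O : I ∘ X ≈ₘ O) (A·X≈O : A · X ≈ₘ O) where

  -- The invariant of the game, for `B` the set of blue non-edges.
  Vanishes : Pred (Rel (Fin n) 0ℓ) 0ℓ
  Vanishes B = ∀ {u v} → B u v → X u v ≈ 0ℝ

  A-adj : ∀ {u v} → Adj G u v → A u v ≉ 0ℝ
  A-adj {u} {v} uv = proj₁ (proj₂ A∈𝒮 u v λ u≡v → adj-irrefl G u≡v uv) uv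

  X-diag : ∀ {u v} → u ≡ v → X u v ≈ 0ℝ
  X-diag {u} ≡.refl with I∘X≈O u u
  ... | IX≈0 rewrite dec-true (u Fin.≟ u) ≡.refl =
    R.trans (R.sym (R.*-identityˡ (X u u))) IX≈0

  X-adj : ∀ {u v} → Adj G u v → X u v ≈ 0ℝ
  X-adj {u} {v} uv = xy≈0∧x≉0⇒y≈0 (A∘X≈O u v) (A-adj uv)

  -- Outside the closed neighborhood of `i` the factor `A i v` is zero. The diagonal entry `A i i`
  -- is arbitrary, which is why `X i k ≈ 0ℝ` is assumed.
  term≈0 : ∀ {i k} → X i k ≈ 0ℝ → ∀ v → (Adj G i v → X v k ≈ 0ℝ) → A i v * X v k ≈ 0ℝ
  term≈0 {i} {k} Xik≈0 v Xvk≈0 with adj? G i v | i Fin.≟ v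
  ... | yes iv | _          = R.trans (R.*-congˡ (Xvk≈0 iv)) (R.zeroʳ (A i v))
  ... | no  _  | yes ≡.refl = R.trans (R.*-congˡ Xik≈0) (R.zeroʳ (A i i))
  ... | no ¬iv | no i≢v     =
    R.trans (R.*-congʳ (proj₂ (proj₂ A∈𝒮 i v i≢v) ¬iv)) (R.zeroˡ (X v k))

  module _ {B : Rel (Fin n) 0ℓ} (X-blue : Vanishes B) where

    -- Starting from a nonzero entry avoids deciding whether a non-edge is blue.
    X-white : ∀ {u v} → X u v ≉ 0ℝ → White G B u v
    X-white X≉0 = ((λ u≡v → X≉0 (X-diag u≡v)) , λ uv → X≉0 (X-adj uv)) , λ uv → X≉0 (X-blue uv)

    X-φ : ∀ {k v} → v ∈ φ G k B → X k v ≈ 0ℝ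
    X-φ (inj₁ (inj₁ v≡k)) = X-diag (≡.sym v≡k)
    X-φ (inj₁ (inj₂ kv))  = X-adj kv
    X-φ (inj₂ kv)         = X-blue kv

    forcingTriple-vanishes : ∀ {k i j} → _⊢_⟶_ G (φ G k B) i j → X j k ≈ 0ℝ
    forcingTriple-vanishes {k} {i} {j} (i∈φ , ij , j∉φ , unique) =
      xy≈0∧x≉0⇒y≈0 Aij*Xjk≈0 (A-adj ij)
      where
      Xik≈0 = R.trans (X-sym i k) (X-φ i∈φ)

      Aij*Xjk≈0 : A i j * X j k ≈ 0ℝ
      Aij*Xjk≈0 = R.trans
        -- Any neighbor `v` of `i` other than `j` cannot be white, since `unique` would give
        -- `v ≡ j`. This only says that `v` is not not blue, which suffices by stability.
        (R.sym (∑-single (λ v → A i v * X v k) j λ v v≢j → term≈0 Xik≈0 v λ iv →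
          ≈0-stable λ Xvk≉0 → v≢j (unique v iv λ v∈φ →
            Xvk≉0 (R.trans (X-sym v k) (X-φ v∈φ)))))
        (A·X≈O i k)

    module _ {i} {C : Pred (Fin n) 0ℓ} (C-component : IsComponent (White G B) (Adj G i) C)
             (C-oddCycle : IsOddCycle (White G B) C) where

      private
        k = proj₁ C-oddCycle
        m = 3 ℕ.+ 2 ℕ.* k

        vertex : Fin m → Fin n
        vertex = proj₁ (proj₂ C-oddCycle)

        vertex-injective = proj₁ (proj₂ (proj₂ C-oddCycle))

        covers : ∀ {v} → v ∈ C → ∃[ s ] vertex s ≡ v
        covers {v} = Equivalence.to (proj₁ (proj₂ (proj₂ (proj₂ C-oddCycle))) v)

        vertex∈C : ∀ s → vertex s ∈ C
        vertex∈C s =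
          Equivalence.from (proj₁ (proj₂ (proj₂ (proj₂ C-oddCycle))) (vertex s)) (s , ≡.refl)

        white⇒cyclic : ∀ {s t} → White G B (vertex s) (vertex t) → CyclicallyAdjacent m s t
        white⇒cyclic {s} {t} = Equivalence.to (proj₂ (proj₂ (proj₂ (proj₂ C-oddCycle))) s t)

        C⊆N : C ⊆ Adj G i
        C⊆N = proj₁ C-component

        -- The cycle unrolled into a periodic sequence.
        c : ℕ → Fin n
        c p = vertex (p mod m)

        i~c : ∀ p → Adj G i (c p)
        i~c p = C⊆N (vertex∈C (p mod m))

        -- A white non-edge from `c (suc p)` to a neighbor of `i` is a path of length one, so `v`
        -- lies in the component `C`; on the cycle only two candidates remain.
        neighbours : ∀ p v → Adj G i v → White G B (c (suc p)) v → v ≡ c p ⊎ v ≡ c (2 ℕ.+ p)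
        neighbours p v iv white
          with t , ≡.refl ← covers (Equivalence.from
                 (proj₂ (proj₂ C-component) (vertex∈C (suc p mod m)) v)
                 ((i~c (suc p) , iv , white) ◅ Star.ε))
          with cyclic-neighbours m p (white⇒cyclic white)
        ... | inj₁ eq = inj₁ (≡.cong vertex eq)
        ... | inj₂ eq = inj₂ (≡.cong vertex eq)

        -- A cycle has length at least 3, so the two neighbors of a vertex contribute separate terms
        -- to the sum in `row-c`.
        c-distinct : ∀ p → c p ≢ c (2 ℕ.+ p)
        c-distinct p eq = 2+p%m≢p%m (2 ℕ.* k) p (begin
          (2 ℕ.+ p) % m            ≡⟨ toℕ-mod m (2 ℕ.+ p) ⟨
          toℕ ((2 ℕ.+ p) mod m)    ≡⟨ ≡.cong toℕ (vertex-injective eq) ⟨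
          toℕ (p mod m)            ≡⟨ toℕ-mod m p ⟩
          p % m                    ∎)
          where open ≡.≡-Reasoning

        a : ℕ → ℝ
        a p = A i (c p)

        x : ℕ → ℝ
        x p = X (c p) (c (suc p))

        row-c : ∀ p → a p * x p + a (2 ℕ.+ p) * x (suc p) ≈ 0ℝ
        row-c p = begin
          a p * x p + a (2 ℕ.+ p) * x (suc p)
            ≈⟨ R.+-congˡ (R.*-congˡ (X-sym (c (suc p)) (c (2 ℕ.+ p)))) ⟩
          a p * x p + a (2 ℕ.+ p) * X (c (2 ℕ.+ p)) (c (suc p))
            ≈⟨ ∑-pair (λ v → A i v * X v (c (suc p))) (c-distinct p) others ⟨
          (A · X) i (c (suc p))
            ≈⟨ A·X≈O i (c (suc p)) ⟩
          0ℝ ∎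
          where
          open ℝ-Reasoning
          others : ∀ v → v ≢ c p → v ≢ c (2 ℕ.+ p) → A i v * X v (c (suc p)) ≈ 0ℝ
          -- The diagonal term drops out because `c (suc p)` is adjacent to `i`. A nonzero entry at
          -- a neighbor of `i` would be a white non-edge, hence one of the two excluded vertices.
          others v v≢cp v≢c[2+p] = term≈0 (X-adj (i~c (suc p))) v λ iv →
            ≈0-stable λ X≉0 → [ v≢cp , v≢c[2+p] ]′
              (neighbours p v iv (X-white λ X≈0 → X≉0 (R.trans (X-sym v (c (suc p))) X≈0)))

        -- The weight `a (suc p)` turns the relation `row-c` into pure alternation:
        -- `y p + y (suc p)` is `a (suc p)` times its left side.
        y : ℕ → ℝ
        y p = a (suc p) * (a p * x p)

        y-alternating : ∀ p → y p + y (suc p) ≈ 0ℝ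
        y-alternating p = begin
          a (suc p) * (a p * x p) + a (2 ℕ.+ p) * (a (suc p) * x (suc p))
            ≈⟨ R.+-congˡ (x∙yz≈y∙xz (a (2 ℕ.+ p)) (a (suc p)) (x (suc p))) ⟩
          a (suc p) * (a p * x p) + a (suc p) * (a (2 ℕ.+ p) * x (suc p))
            ≈⟨ R.distribˡ (a (suc p)) _ _ ⟨
          a (suc p) * (a p * x p + a (2 ℕ.+ p) * x (suc p))
            ≈⟨ R.*-congˡ (row-c p) ⟩
          a (suc p) * 0ℝ
            ≈⟨ R.zeroʳ (a (suc p)) ⟩
          0ℝ ∎
          where
          open ℝ-Reasoning
          open import Algebra.Properties.CommutativeSemigroup R.*-commutativeSemigroup
            using (x∙yz≈y∙xz)

        c-periodic : ∀ p → c (m ℕ.+ p) ≡ c p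
        c-periodic p = ≡.cong vertex (mod-+-period m p)

        y-periodic : ∀ p → y (m ℕ.+ p) ≈ y p
        y-periodic p = R.reflexive (≡.cong₂ (λ u v → A i v * (A i u * X u v))
          (c-periodic p)
          (≡.trans (≡.cong c (≡.sym (ℕ.+-suc m p))) (c-periodic (suc p))))

        x≈0 : ∀ p → x p ≈ 0ℝ
        -- Both weights in `y p` are entries of `A` on edges of `G`, so they cancel.
        x≈0 p = xy≈0∧x≉0⇒y≈0
          (xy≈0∧x≉0⇒y≈0 (alternating-odd-period y y-alternating k y-periodic p)
            (A-adj (i~c (suc p))))
          (A-adj (i~c p))

      oddCycle-vanishes : Vanishes (White G B ↾ C)
      oddCycle-vanishes (u∈C , v∈C , white)
        with s , ≡.refl ← covers u∈C | t , ≡.refl ← covers v∈C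
        with cyclic-consecutive m (white⇒cyclic white)
      ... | p , inj₁ (≡.refl , ≡.refl) = x≈0 p
      ... | p , inj₂ (≡.refl , ≡.refl) = R.trans (X-sym (c (suc p)) (c p)) (x≈0 p)

    step-vanishes : ∀ {B′} → Step G B B′ → Vanishes B′
    step-vanishes (forcingTriple k i j _ i⟶j) = λ where
      (inj₁ uv)                        → X-blue uv
      (inj₂ (inj₁ (≡.refl , ≡.refl))) → forcingTriple-vanishes i⟶j
      (inj₂ (inj₂ (≡.refl , ≡.refl))) → R.trans (X-sym k j) (forcingTriple-vanishes i⟶j)
    step-vanishes (oddCycle i C C-component C-oddCycle) =
      [ X-blue , oddCycle-vanishes C-component C-oddCycle ]′

  star-vanishes : ∀ {B B′} → Star (Step G) B B′ → Vanishes B → Vanishes B′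
  star-vanishes Star.ε         X-blue = X-blue
  star-vanishes (step ◅ steps) X-blue = star-vanishes steps (step-vanishes X-blue step)

-- From the game to the Strong Arnold Property and the parameters

zero-Z-SAP⇒SAP : (G : Graph n) → 0 ∈ Z-SAP G → 𝒮 G ⊆ HasSAP
zero-Z-SAP⇒SAP G ((B , (_ , B′ , steps , all-blue) , no-edges) , _) A∈𝒮 X X-sym A∘X I∘X A·X u v =
  -- A nonzero entry must sit at a non-edge, and every non-edge belongs to the final blue set `B′`,
  -- on which `X` vanishes.
  ≈0-stable λ X≉0 → X≉0 (X-blue (all-blue (proj₁ (X-white G A∈𝒮 X-sym A∘X I∘X A·X X-blue X≉0))))
  where
  X-blue : Vanishes G A∈𝒮 X-sym A∘X I∘X A·X B′
  X-blue = star-vanishes G A∈𝒮 X-sym A∘X I∘X A·X steps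
    -- The invariant holds vacuously at the start, since the initial blue set is empty.
    λ uv → contradiction uv (edges-empty B no-edges)

maxNullity-cong : {F F′ : Pred (Matrix n) 0ℓ} → F ≐ F′ → maxNullity F ≐ maxNullity F′
maxNullity-cong (F⊆F′ , F′⊆F) = half F⊆F′ F′⊆F , half F′⊆F F⊆F′
  where
  half : ∀ {F F′} → F ⊆ F′ → F′ ⊆ F → maxNullity F ⊆ maxNullity F′
  half F⊆F′ F′⊆F ((A , A∈F , dim) , maximal) =
    (A , F⊆F′ A∈F , dim) , λ d (A′ , A′∈F′ , dim′) → maximal d (A′ , F′⊆F A′∈F′ , dim′)

-- Intersecting with `HasSAP` removes no matrix from `F`, so both maxima range over the same
-- matrices.
maxNullity-SAP : {F : Pred (Matrix n) 0ℓ} → F ⊆ HasSAP → maxNullity F ≐ maxNullity (F ∩ HasSAP)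
maxNullity-SAP F⊆SAP = maxNullity-cong ((λ A∈F → A∈F , F⊆SAP A∈F) , proj₁)

theorem2p6 : ∀ {n : ℕ} (G : Graph n) → 0 ∈ Z-SAP G →
    (𝒮 G ⊆ HasSAP) × (M G ≐ ξ G) × (M₊ G ≐ ν G) × (Mμ G ≐ μ G)
theorem2p6 G Z≡0 = SAP , maxNullity-SAP SAP ,
  maxNullity-SAP (λ A∈ → SAP (proj₁ A∈)) , maxNullity-SAP (λ A∈ → SAP (proj₁ A∈))
  where
  SAP : 𝒮 G ⊆ HasSAP
  SAP = zero-Z-SAP⇒SAP G Z≡0
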